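{- Let $k\ge 2$. For every $k$-uniform hypergraph $H$ on $n$ vertices, $\mathrm{mc}_k(H)\leq n-\alpha_k^*(H)$.
   Context: Hypergraphs are finite with nonempty vertex set. The shadow-graph $H^{(2)}$ of a hypergraph $H$ is the graph on $V(H)$ in which $\{x,y\}$ is an edge if and only if some $e\in E(H)$ satisfies $\{x,y\}\subseteq e$. $H$ is connected if $H^{(2)}$ is connected, and the components of $H$ are its maximal connected subgraphs (so an isolated vertex is a component on one vertex). An $r$-coloring of $H$ is a partition $\{E_1,\dots,E_r\}$ of $E(H)$ in which some of the sets may be empty. A monochromatic component of $H$ (with respect to this coloring) is a component of the hypergraph $(V(H),E_i)$ for some $i\in\{1,\dots,r\}$. $\mathrm{mc}_r(H)$ is the largest integer $m$ such that in every $r$-coloring of the edges of $H$ there is a monochromatic component on at least $m$ vertices. The $k$-partite-hole number $\alpha_k^*(H)$ is the maximum integer $a$ such that there exist pairwise disjoint sets $X_1,\dots,X_k\subseteq V(H)$ with $|X_1|=\dots=|X_k|=a$ such that for every $e\in E(H)$ there is $i\in\{1,\dots,k\}$ with $e\cap X_i=\emptyset$. -}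

module Defs where

open import Data.Bool using (Bool; T)
open import Data.Nat using (ℕ; _≤_)
open import Data.Fin using (Fin)
open import Data.Fin.Subset using (Subset; _∈_; _⊆_; _∩_; ∣_∣; Nonempty; Empty)
open import Data.Product using (∃-syntax; _×_)
open import Level using (0ℓ)
open import Relation.Binary using (Rel)
open import Relation.Binary.Construct.Closure.ReflexiveTransitive using (Star)
open import Relation.Binary.PropositionalEquality using (_≡_; _≢_)

-- A set of subsets of Fin N, given by its characteristic function.
EdgeSet : ℕ → Set
EdgeSet N = Subset N → Bool

infix 4 _∈ᴱ_ _⊆ᴱ_ _⊆ᴴ_

_∈ᴱ_ : ∀ {N} → Subset N → EdgeSet N → Set
e ∈ᴱ E = T (E e)

_⊆ᴱ_ : ∀ {N} → EdgeSet N → EdgeSet N → Set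
E ⊆ᴱ F = ∀ {e} → e ∈ᴱ E → e ∈ᴱ F

-- The vertex set is an arbitrary nonempty subset V of an ambient Fin N, so that
-- a hypergraph and its subgraphs live in the same type.  The number of vertices
-- is ∣ V ∣, not N.
record Hypergraph (N : ℕ) : Set where
  field
    V          : Subset N
    V-nonempty : Nonempty V
    E          : EdgeSet N
    E⊆V        : ∀ {e} → e ∈ᴱ E → e ⊆ V

open Hypergraph public

Uniform : ∀ {N} → ℕ → Hypergraph N → Set
Uniform k H = ∀ {e} → e ∈ᴱ E H → ∣ e ∣ ≡ k

_⊆ᴴ_ : ∀ {N} → Hypergraph N → Hypergraph N → Set
K ⊆ᴴ H = V K ⊆ V H × E K ⊆ᴱ E H

-- Adjacency in the shadow graph H⁽²⁾.
Shadow : ∀ {N} → Hypergraph N → Rel (Fin N) 0ℓ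
Shadow H x y = x ≢ y × ∃[ e ] (e ∈ᴱ E H × x ∈ e × y ∈ e)

Connected : ∀ {N} → Hypergraph N → Set
Connected H = ∀ {x y} → x ∈ V H → y ∈ V H → Star (Shadow H) x y

record IsComponent {N : ℕ} (H K : Hypergraph N) : Set where
  field
    subgraph  : K ⊆ᴴ H
    connected : Connected K
    maximal   : ∀ L → L ⊆ᴴ H → Connected L → K ⊆ᴴ L → L ⊆ᴴ K

record Coloring {N : ℕ} (r : ℕ) (H : Hypergraph N) : Set where
  field
    class    : Fin r → EdgeSet N
    class⊆E  : ∀ i → class i ⊆ᴱ E H
    covers   : ∀ {e} → e ∈ᴱ E H → ∃[ i ] e ∈ᴱ class i
    disjoint : ∀ {e i j} → e ∈ᴱ class i → e ∈ᴱ class j → i ≡ j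

  -- The hypergraph (V(H), Eᵢ).
  colorGraph : Fin r → Hypergraph N
  colorGraph i = record
    { V          = V H
    ; V-nonempty = V-nonempty H
    ; E          = class i
    ; E⊆V        = λ e∈Eᵢ → E⊆V H (class⊆E i e∈Eᵢ)
    }

open Coloring public

IsMonochromaticComponent : ∀ {N r} {H : Hypergraph N} →
                           Coloring r H → Hypergraph N → Set
IsMonochromaticComponent c K = ∃[ i ] IsComponent (colorGraph c i) K

IsMaximum : (ℕ → Set) → ℕ → Set
IsMaximum P m = P m × (∀ m′ → P m′ → m′ ≤ m)

-- m = mc_r(H)
IsMc : ∀ {N} → ℕ → Hypergraph N → ℕ → Set
IsMc r H = IsMaximum λ m →
  (c : Coloring r H) → ∃[ K ] (IsMonochromaticComponent c K × m ≤ ∣ V K ∣)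

record PartiteHole {N : ℕ} (k : ℕ) (H : Hypergraph N) (a : ℕ) : Set where
  field
    X        : Fin k → Subset N
    X⊆V      : ∀ i → X i ⊆ V H
    size     : ∀ i → ∣ X i ∣ ≡ a
    disjoint : ∀ {i j} → i ≢ j → Empty (X i ∩ X j)
    hole     : ∀ {e} → e ∈ᴱ E H → ∃[ i ] Empty (e ∩ X i)

-- a = α*_k(H)
IsPartiteHoleNumber : ∀ {N} → ℕ → Hypergraph N → ℕ → Set
IsPartiteHoleNumber k H = IsMaximum (PartiteHole k H)

{-# OPTIONS --safe #-}
module Submission where

open import Data.Nat using (ℕ) renaming (_≤_ to _≤ℕ_)
open import Data.Integer using (+_; _-_; _≤_)
open import Data.Fin.Subset using (∣_∣)
open import Defs

open import Data.Bool.Properties using (T?; T-irrelevant)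
open import Data.Fin using (Fin; zero; suc; _≟_)
open import Data.Fin.Subset
  using (Subset; inside; outside; _∈_; _⊆_; _∩_; _∪_; ⁅_⁆; Empty; Nonempty)
open import Data.Fin.Subset.Properties
  using ( drop-∷-Empty; x∈p∩q⁺; x∈p∩q⁻; x∈p∪q⁻; p⊆q⇒∣p∣≤∣q∣; nonempty?
        ; x∈⁅x⁆; x∈⁅y⁆⇒x≡y; ∣⁅x⁆∣≡1)
import Data.Integer as ℤ using (+≤+)
import Data.Integer.Properties as ℤ
import Data.Nat as ℕ
import Data.Nat.Properties as ℕ
open import Data.Product using (Σ; _,_; proj₁; proj₂)
open import Data.Sum using ([_,_]′)
open import Data.Vec using ([]; _∷_; here)
open import Function using (_∘_)
open import Relation.Binary.Construct.Closure.ReflexiveTransitive using (Star; ε; _◅_)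
open import Relation.Binary.PropositionalEquality
  using (_≡_; refl; sym; trans; cong; cong₂; subst)
open import Relation.Nullary using (Dec; yes; no; ¬_; contradiction)
open import Relation.Nullary.Decidable using (⌊_⌋; toWitness; fromWitness; map′)

-- Given disjoint X₁,…,X_k of size a forming a hole, colour each edge by an index
-- i for which it misses Xᵢ.  In colour i every vertex of Xᵢ is isolated, so a
-- component of colour i either is a single vertex or avoids Xᵢ.  It therefore has
-- at most n − a vertices; a singleton does since n ≥ 2a (as k ≥ 2) and n ≥ 1.

private
  variable
    N r k a : ℕ
    p q s : Subset N

∣p∪q∣≡∣p∣+∣q∣ : ∀ (p q : Subset N) → Empty (p ∩ q) → ∣ p ∪ q ∣ ≡ ∣ p ∣ ℕ.+ ∣ q ∣
∣p∪q∣≡∣p∣+∣q∣ []            []            _   = refl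
∣p∪q∣≡∣p∣+∣q∣ (inside  ∷ p) (inside  ∷ q) p∩q = contradiction (zero , here) p∩q
∣p∪q∣≡∣p∣+∣q∣ (inside  ∷ p) (outside ∷ q) p∩q =
  cong ℕ.suc (∣p∪q∣≡∣p∣+∣q∣ p q (drop-∷-Empty p∩q))
∣p∪q∣≡∣p∣+∣q∣ (outside ∷ p) (inside  ∷ q) p∩q =
  trans (cong ℕ.suc (∣p∪q∣≡∣p∣+∣q∣ p q (drop-∷-Empty p∩q))) (sym (ℕ.+-suc ∣ p ∣ ∣ q ∣))
∣p∪q∣≡∣p∣+∣q∣ (outside ∷ p) (outside ∷ q) p∩q =
  ∣p∪q∣≡∣p∣+∣q∣ p q (drop-∷-Empty p∩q)

disjoint⇒∣p∣+∣q∣≤∣s∣ : p ⊆ s → q ⊆ s → Empty (p ∩ q) → ∣ p ∣ ℕ.+ ∣ q ∣ ≤ℕ ∣ s ∣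
disjoint⇒∣p∣+∣q∣≤∣s∣ {p = p} {q = q} p⊆s q⊆s p∩q =
  subst (_≤ℕ _) (∣p∪q∣≡∣p∣+∣q∣ p q p∩q)
    (p⊆q⇒∣p∣≤∣q∣ ([ p⊆s , q⊆s ]′ ∘ x∈p∪q⁻ p q))

nonempty⇒1≤∣p∣ : Nonempty p → 1 ≤ℕ ∣ p ∣
nonempty⇒1≤∣p∣ {p = p} (x , x∈p) = subst (_≤ℕ ∣ p ∣) (∣⁅x⁆∣≡1 x)
  (p⊆q⇒∣p∣≤∣q∣ λ y∈⁅x⁆ → subst (_∈ p) (sym (x∈⁅y⁆⇒x≡y x y∈⁅x⁆)) x∈p)

module _ (H : Hypergraph N) (colour : ∀ {e} → e ∈ᴱ E H → Fin r) where

  -- Edge classes are Boolean-valued, so having colour `i` must be decidable. As `colour` takes a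
  -- membership proof as argument, `T-irrelevant` is what makes the colour depend on the edge alone.
  hasColour? : ∀ i e → Dec (Σ (e ∈ᴱ E H) λ e∈E → colour e∈E ≡ i)
  hasColour? i e with T? (E H e)
  ... | no  e∉E = no (e∉E ∘ proj₁)
  ... | yes e∈E = map′ (e∈E ,_)
    (λ (e∈E′ , eq) → trans (cong colour (T-irrelevant e∈E e∈E′)) eq) (colour e∈E ≟ i)

  fromColour : Coloring r H
  fromColour = record
    { class    = λ i e → ⌊ hasColour? i e ⌋
    ; class⊆E  = λ i → proj₁ ∘ toWitness
    ; covers   = λ e∈E → colour e∈E , fromWitness (e∈E , refl)
    ; disjoint = λ e∈Eᵢ e∈Eⱼ →
        let (e∈E , eq) = toWitness e∈Eᵢ ; (e∈E′ , eq′) = toWitness e∈Eⱼ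
        in trans (sym eq) (trans (cong colour (T-irrelevant e∈E e∈E′)) eq′)
    }

Isolated : Hypergraph N → Fin N → Set
Isolated H x = ∀ {e} → e ∈ᴱ E H → ¬ x ∈ e

-- A nontrivial path from `x` would begin with an edge containing `x`, so only the empty path leaves
-- `x`.
connected∧isolated⇒∣V∣≤1 : ∀ (K : Hypergraph N) {x} →
  Connected K → x ∈ V K → Isolated K x → ∣ V K ∣ ≤ℕ 1
connected∧isolated⇒∣V∣≤1 K {x} conn x∈V iso =
  subst (∣ V K ∣ ≤ℕ_) (∣⁅x⁆∣≡1 x) (p⊆q⇒∣p∣≤∣q∣ λ y∈V → onlyReach (conn x∈V y∈V))
  where
  onlyReach : ∀ {y} → Star (Shadow K) x y → y ∈ ⁅ x ⁆
  onlyReach ε = x∈⁅x⁆ x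
  onlyReach ((_ , _ , e∈E , x∈e , _) ◅ _) = contradiction x∈e (iso e∈E)

1+a≤∣V∣ : 2 ≤ℕ k → (H : Hypergraph N) → PartiteHole k H a → 1 ℕ.+ a ≤ℕ ∣ V H ∣
1+a≤∣V∣ {a = ℕ.zero} _ H _ = nonempty⇒1≤∣p∣ (V-nonempty H)
-- Matching on `2 ≤ k` makes `zero` and `suc zero` available as indices. The two disjoint sets there
-- give twice the hole size, which exceeds the hole size by at least one since that size is
-- positive.
1+a≤∣V∣ {a = ℕ.suc a} (ℕ.s≤s (ℕ.s≤s _)) H P =
  ℕ.≤-trans (ℕ.+-monoˡ-≤ (ℕ.suc a) (ℕ.s≤s ℕ.z≤n))
    (subst (_≤ℕ ∣ V H ∣) (cong₂ ℕ._+_ (size zero) (size (suc zero)))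
      (disjoint⇒∣p∣+∣q∣≤∣s∣ (X⊆V zero) (X⊆V (suc zero)) (PartiteHole.disjoint P λ ())))
  where open PartiteHole P

module _ (2≤k : 2 ≤ℕ k) (H : Hypergraph N) (P : PartiteHole k H a) where
  open PartiteHole P

  holeColoring : Coloring k H
  holeColoring = fromColour H (proj₁ ∘ hole)

  class-misses-X : ∀ i {e} → e ∈ᴱ class holeColoring i → Empty (e ∩ X i)
  class-misses-X i {e} e∈Eᵢ with toWitness {a? = hasColour? H (proj₁ ∘ hole) i e} e∈Eᵢ
  -- `refl` identifies `i` with the index that `hole` chose for `e`.
  ... | e∈E , refl = proj₂ (hole e∈E)

  -- Split on whether the component meets the set `X i` of its own colour. The bound is stated as a
  -- sum to avoid truncated subtraction.
  monochromatic-bound : ∀ K → IsMonochromaticComponent holeColoring K →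
                        ∣ V K ∣ ℕ.+ a ≤ℕ ∣ V H ∣
  monochromatic-bound K (i , comp) with nonempty? (V K ∩ X i)
  ... | no  V∩X = subst (λ b → ∣ V K ∣ ℕ.+ b ≤ℕ ∣ V H ∣) (size i)
    (disjoint⇒∣p∣+∣q∣≤∣s∣ (proj₁ (IsComponent.subgraph comp)) (X⊆V i) V∩X)
  ... | yes (x , x∈V∩X) =
    let (x∈V , x∈X) = x∈p∩q⁻ (V K) (X i) x∈V∩X
        -- Edges of `K` have colour `i`, hence miss `X i`, which contains `x`.
        isolated : Isolated K x
        isolated e∈E x∈e =
          class-misses-X i (proj₂ (IsComponent.subgraph comp) e∈E) (x , x∈p∩q⁺ (x∈e , x∈X))
    in ℕ.≤-trans
         (ℕ.+-monoˡ-≤ a (connected∧isolated⇒∣V∣≤1 K (IsComponent.connected comp) x∈V isolated))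
         (1+a≤∣V∣ 2≤k H P)

-- The hypothesis forces `a ≤ n`, so integer and truncated differences agree.
m+a≤n⇒m≤n-a : ∀ {m a n} → m ℕ.+ a ≤ℕ n → + m ≤ + n - + a
m+a≤n⇒m≤n-a {m} {a} {n} m+a≤n = subst (+ m ≤_)
  (sym (trans (ℤ.m-n≡m⊖n n a) (ℤ.⊖-≥ (ℕ.m+n≤o⇒n≤o m m+a≤n))))
  (ℤ.+≤+ (ℕ.m+n≤o⇒m≤o∸n m m+a≤n))

proposition1p1 : ∀ (k : ℕ) → 2 ≤ℕ k → ∀ {N : ℕ} (H : Hypergraph N) → Uniform k H →
    ∀ (m a : ℕ) → IsMc k H m → IsPartiteHoleNumber k H a →
    + m ≤ + ∣ V H ∣ - + a
proposition1p1 k 2≤k H _ m a (mc , _) (P , _) =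
  -- Every colouring has a component on at least `m` vertices; testing this on the hole colouring
  -- suffices.
  let (K , mono , m≤∣V∣) = mc (holeColoring 2≤k H P)
  in m+a≤n⇒m≤n-a (ℕ.≤-trans (ℕ.+-monoˡ-≤ a m≤∣V∣) (monochromatic-bound 2≤k H P K mono))
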